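{- Let $\mathcal{S}\subset(\mathbb{N}\cup\{\infty\})^6$ be the set of the following 13 vectors: $B=(\infty,\infty,\infty,\infty,\infty,\infty)$, $2S=(\infty,\infty,\infty,\infty,\infty,1)$, $RS=(\infty,\infty,\infty,\infty,1,1)$, $PF=(\infty,2,\infty,\infty,\infty,1)$, $S=(\infty,\infty,\infty,\infty,0,0)$, $RT=(\infty,\infty,\infty,1,1,1)$, $FT=(\infty,\infty,\infty,0,1,1)$, $R=(\infty,2,1,1,1,1)$, $RV=(\infty,2,1,0,1,1)$, $IF=(\infty,2,0,0,\infty,1)$, $F=(\infty,2,0,0,1,1)$, $T=(\infty,1,0,0,0,0)$, $E=(1,1,0,0,0,0)$. Then $\mathcal{S}$ is not a sublattice of $(\mathbb{N}\cup\{\infty\})^6$ under componentwise $\min/\max$, and the sublattice $L_{30}$ it generates has exactly $30$ elements (so the closure adds $17$ elements not in $\mathcal{S}$); moreover, iterating the operation of adjoining all pairwise componentwise meets and joins stabilizes after three rounds.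
   Context: $(\mathbb{N}\cup\{\infty\})^6$ is ordered componentwise with $\infty$ above every natural number; meet and join are componentwise $\min$ and $\max$. These 13 vectors are Bisping's energy vectors of the named equivalences (bisimulation, 2-nested simulation, ready simulation, possible futures, simulation, ready traces, failure traces, readiness, revivals, impossible futures, failures, traces, enabledness). -}

module Defs where

open import Algebra.Core using (Op₂)
open import Data.List.Base using (List; []; _∷_; length)
open import Data.List.Membership.Propositional using (_∈_)
open import Data.List.Relation.Unary.Unique.Propositional using (Unique)
open import Data.Nat.Base as ℕ using (ℕ; zero; suc)
open import Data.Nat.Properties as ℕ using ()
open import Data.Product.Base using (_×_; _,_; ∃-syntax; Σ-syntax)
open import Data.Sum.Base using (_⊎_)
open import Data.Vec.Base using (Vec; []; _∷_; zipWith)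
open import Data.Vec.Relation.Binary.Pointwise.Inductive as Pointwise
  using (Pointwise; []; _∷_)
open import Function.Bundles using (_⇔_)
open import Level using (Level; 0ℓ; _⊔_)
open import Relation.Binary.Bundles using (TotalOrder)
open import Relation.Binary.Construct.Add.Supremum.NonStrict ℕ._≤_
  using (≤⁺-isTotalOrder-≡)
open import Relation.Binary.Core using (Rel)
open import Relation.Binary.Lattice.Bundles using (Lattice)
open import Relation.Binary.PropositionalEquality
  using (_≡_; refl; isEquivalence)
open import Relation.Binary.Structures using (IsPartialOrder)
open import Relation.Nullary.Construct.Add.Supremum using (_⁺; ⊤⁺; [_])
open import Relation.Unary using (Pred; _⊆_)

import Algebra.Construct.NaturalChoice.Max as Max
import Algebra.Construct.NaturalChoice.Min as Min

private
  variable
    a p q : Level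

ℕ∞ : Set
ℕ∞ = ℕ ⁺

pattern ∞ = ⊤⁺

ℕ∞-totalOrder : TotalOrder 0ℓ 0ℓ 0ℓ
ℕ∞-totalOrder = record { isTotalOrder = ≤⁺-isTotalOrder-≡ ℕ.≤-isTotalOrder }

private
  module ℕ∞ where
    open TotalOrder ℕ∞-totalOrder public
    open Min ℕ∞-totalOrder public
    open Max ℕ∞-totalOrder public

Energy : Set
Energy = Vec ℕ∞ 6

infix  4 _≤_
infixr 6 _∨_
infixr 7 _∧_

_≤_ : Rel Energy 0ℓ
_≤_ = Pointwise ℕ∞._≤_

_∧_ _∨_ : Op₂ Energy
_∧_ = zipWith ℕ∞._⊓_
_∨_ = zipWith ℕ∞._⊔_

energyLattice : Lattice 0ℓ 0ℓ 0ℓ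
energyLattice = record
  { Carrier   = Energy
  ; _≈_       = _≡_
  ; _≤_       = _≤_
  ; _∨_       = _∨_
  ; _∧_       = _∧_
  ; isLattice = record
    { isPartialOrder = isPartialOrder
    ; supremum       = λ x y → x≤x∨y x y , y≤x∨y x y , λ z → ∨-least
    ; infimum        = λ x y → x∧y≤x x y , x∧y≤y x y , λ z → ∧-greatest
    }
  }
  where
  isPartialOrder : IsPartialOrder _≡_ _≤_
  isPartialOrder = record
    { isPreorder = record
      { isEquivalence = isEquivalence
      ; reflexive     = λ { refl → Pointwise.refl ℕ∞.refl }
      ; trans         = Pointwise.trans ℕ∞.trans
      }
    ; antisym = λ x≤y y≤x → Pointwise.Pointwise-≡⇒≡ (antisym x≤y y≤x)
    }
    where
    antisym : ∀ {n} {xs ys : Vec ℕ∞ n} → Pointwise ℕ∞._≤_ xs ys →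
              Pointwise ℕ∞._≤_ ys xs → Pointwise _≡_ xs ys
    antisym []       []       = []
    antisym (p ∷ ps) (q ∷ qs) = ℕ∞.antisym p q ∷ antisym ps qs

  x≤x∨y : ∀ {n} (xs ys : Vec ℕ∞ n) →
          Pointwise ℕ∞._≤_ xs (zipWith ℕ∞._⊔_ xs ys)
  x≤x∨y []       []       = []
  x≤x∨y (x ∷ xs) (y ∷ ys) = ℕ∞.x≤x⊔y x y ∷ x≤x∨y xs ys

  y≤x∨y : ∀ {n} (xs ys : Vec ℕ∞ n) →
          Pointwise ℕ∞._≤_ ys (zipWith ℕ∞._⊔_ xs ys)
  y≤x∨y []       []       = []
  y≤x∨y (x ∷ xs) (y ∷ ys) = ℕ∞.x≤y⊔x x y ∷ y≤x∨y xs ys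

  ∨-least : ∀ {n} {xs ys zs : Vec ℕ∞ n} → Pointwise ℕ∞._≤_ xs zs →
            Pointwise ℕ∞._≤_ ys zs → Pointwise ℕ∞._≤_ (zipWith ℕ∞._⊔_ xs ys) zs
  ∨-least []       []       = []
  ∨-least (p ∷ ps) (q ∷ qs) = ℕ∞.⊔-lub p q ∷ ∨-least ps qs

  x∧y≤x : ∀ {n} (xs ys : Vec ℕ∞ n) →
          Pointwise ℕ∞._≤_ (zipWith ℕ∞._⊓_ xs ys) xs
  x∧y≤x []       []       = []
  x∧y≤x (x ∷ xs) (y ∷ ys) = ℕ∞.x⊓y≤x x y ∷ x∧y≤x xs ys

  x∧y≤y : ∀ {n} (xs ys : Vec ℕ∞ n) →
          Pointwise ℕ∞._≤_ (zipWith ℕ∞._⊓_ xs ys) ys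
  x∧y≤y []       []       = []
  x∧y≤y (x ∷ xs) (y ∷ ys) = ℕ∞.x⊓y≤y x y ∷ x∧y≤y xs ys

  ∧-greatest : ∀ {n} {xs ys zs : Vec ℕ∞ n} → Pointwise ℕ∞._≤_ zs xs →
               Pointwise ℕ∞._≤_ zs ys → Pointwise ℕ∞._≤_ zs (zipWith ℕ∞._⊓_ xs ys)
  ∧-greatest []       []       = []
  ∧-greatest (p ∷ ps) (q ∷ qs) = ℕ∞.⊓-glb p q ∷ ∧-greatest ps qs

record IsSublattice (P : Pred Energy p) : Set p where
  field
    ∧-closed : ∀ {x y} → P x → P y → P (x ∧ y)
    ∨-closed : ∀ {x y} → P x → P y → P (x ∨ y)

-- The least sublattice containing P; see the two lemmas that follow.
data Generated (P : Pred Energy p) : Pred Energy p where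
  base : ∀ {x}   → P x → Generated P x
  meet : ∀ {x y} → Generated P x → Generated P y → Generated P (x ∧ y)
  join : ∀ {x y} → Generated P x → Generated P y → Generated P (x ∨ y)

generated-isSublattice : (P : Pred Energy p) → IsSublattice (Generated P)
generated-isSublattice P = record { ∧-closed = meet ; ∨-closed = join }

generated-least : {P : Pred Energy p} {Q : Pred Energy q} →
                  IsSublattice Q → P ⊆ Q → Generated P ⊆ Q
generated-least sub P⊆Q (base Px)   = P⊆Q Px
generated-least sub P⊆Q (meet g g′) = IsSublattice.∧-closed sub
  (generated-least sub P⊆Q g) (generated-least sub P⊆Q g′)
generated-least sub P⊆Q (join g g′) = IsSublattice.∨-closed sub
  (generated-least sub P⊆Q g) (generated-least sub P⊆Q g′)

-- One round keeps P and adds all meets and joins of pairs taken from P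
-- itself, not from elements added earlier in the same round.
adjoin : Pred Energy p → Pred Energy p
adjoin P z = P z ⊎ (∃[ x ] ∃[ y ] P x × P y × (z ≡ x ∧ y ⊎ z ≡ x ∨ y))

rounds : ℕ → Pred Energy p → Pred Energy p
rounds zero    P = P
rounds (suc n) P = adjoin (rounds n P)

-- A duplicate-free list enumerates P.  (Counting the type Σ A P would be
-- wrong: Generated and adjoin have many proofs for one element.)
HasCardinality : {A : Set a} → Pred A p → ℕ → Set (a ⊔ p)
HasCardinality {A = A} P n =
  Σ[ xs ∈ List A ] Unique xs × length xs ≡ n × (∀ x → x ∈ xs ⇔ P x)

B 2S RS PF S RT FT R RV IF F T E : Energy
B  = ∞     ∷ ∞     ∷ ∞     ∷ ∞     ∷ ∞     ∷ ∞     ∷ []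
2S = ∞     ∷ ∞     ∷ ∞     ∷ ∞     ∷ ∞     ∷ [ 1 ] ∷ []
RS = ∞     ∷ ∞     ∷ ∞     ∷ ∞     ∷ [ 1 ] ∷ [ 1 ] ∷ []
PF = ∞     ∷ [ 2 ] ∷ ∞     ∷ ∞     ∷ ∞     ∷ [ 1 ] ∷ []
S  = ∞     ∷ ∞     ∷ ∞     ∷ ∞     ∷ [ 0 ] ∷ [ 0 ] ∷ []
RT = ∞     ∷ ∞     ∷ ∞     ∷ [ 1 ] ∷ [ 1 ] ∷ [ 1 ] ∷ []
FT = ∞     ∷ ∞     ∷ ∞     ∷ [ 0 ] ∷ [ 1 ] ∷ [ 1 ] ∷ []
R  = ∞     ∷ [ 2 ] ∷ [ 1 ] ∷ [ 1 ] ∷ [ 1 ] ∷ [ 1 ] ∷ []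
RV = ∞     ∷ [ 2 ] ∷ [ 1 ] ∷ [ 0 ] ∷ [ 1 ] ∷ [ 1 ] ∷ []
IF = ∞     ∷ [ 2 ] ∷ [ 0 ] ∷ [ 0 ] ∷ ∞     ∷ [ 1 ] ∷ []
F  = ∞     ∷ [ 2 ] ∷ [ 0 ] ∷ [ 0 ] ∷ [ 1 ] ∷ [ 1 ] ∷ []
T  = ∞     ∷ [ 1 ] ∷ [ 0 ] ∷ [ 0 ] ∷ [ 0 ] ∷ [ 0 ] ∷ []
E  = [ 1 ] ∷ [ 1 ] ∷ [ 0 ] ∷ [ 0 ] ∷ [ 0 ] ∷ [ 0 ] ∷ []

𝒮 : Pred Energy 0ℓ
𝒮 x = x ∈ (B ∷ 2S ∷ RS ∷ PF ∷ S ∷ RT ∷ FT ∷ R ∷ RV ∷ IF ∷ F ∷ T ∷ E ∷ [])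

L₃₀ : Pred Energy 0ℓ
L₃₀ = Generated 𝒮

{-# OPTIONS --safe #-}

-- For a predicate enumerated by a list, one round of adjoining meets and joins
-- is again enumerated by a list, so the whole theorem reduces to decidable
-- inclusions between the lists of 13, 26 and 30 elements reached after zero,
-- one and two rounds.  The last of these is closed, hence equal to L₃₀.

module Submission where

open import Defs
open import Data.List.Base using (List; []; _∷_; _++_; cartesianProductWith)
open import Data.List.Membership.Propositional using (_∈_)
open import Data.List.Membership.Propositional.Properties
  using (∈-++⁺ˡ; ∈-++⁺ʳ; ∈-++⁻; ∈-cartesianProductWith⁺; ∈-cartesianProductWith⁻)
open import Data.List.Relation.Unary.All using (All; all?)
import Data.List.Relation.Unary.All as All
open import Data.Nat.Base using (ℕ; zero; suc) renaming (_≤_ to _≤ℕ_)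
import Data.Nat.Base as ℕ
import Data.Nat.Properties as ℕ
open import Data.Product.Base using (_×_; _,_)
open import Data.Sum.Base using (inj₁; inj₂; [_,_]′)
open import Data.Vec.Properties using (≡-dec)
open import Function.Base using (_∘_)
open import Function.Bundles using (mk⇔)
open import Level using (Level)
open import Relation.Binary.Definitions using (DecidableEquality)
open import Relation.Binary.PropositionalEquality using (refl)
open import Relation.Nullary.Construct.Add.Supremum using () renaming (≡-dec to ⁺-≡-dec)
open import Relation.Nullary.Decidable using (from-yes; from-no; ¬?)
open import Relation.Nullary.Negation.Core using (¬_; contradiction)
open import Relation.Unary using (Pred; _⊆_; _∩_; ∁; _≐_)

_≟_ : DecidableEquality Energy
_≟_ = ≡-dec (⁺-≡-dec ℕ._≟_)

open import Data.List.Membership.DecPropositional _≟_ using (_∈?_)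
open import Data.List.Relation.Binary.Subset.DecPropositional _≟_
  using (_⊆?_) renaming (_⊆_ to _⊆ᴸ_)
open import Data.List.Relation.Unary.Unique.DecPropositional _≟_ using (unique?)

private
  variable
    p q : Level
    P : Pred Energy p
    Q : Pred Energy q

adjoin-mono : P ⊆ Q → adjoin P ⊆ adjoin Q
adjoin-mono P⊆Q (inj₁ Px)                     = inj₁ (P⊆Q Px)
adjoin-mono P⊆Q (inj₂ (x , y , Px , Py , eq)) = inj₂ (x , y , P⊆Q Px , P⊆Q Py , eq)

-- Carries what is found at round two over to all later rounds: each round keeps its input and is
-- monotone in it.
rounds-mono : ∀ {m n} → m ≤ℕ n → rounds m P ⊆ rounds n P
rounds-mono {n = zero}  ℕ.z≤n       Px = Px
rounds-mono {n = suc n} ℕ.z≤n       Px = inj₁ (rounds-mono {n = n} ℕ.z≤n Px)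
rounds-mono             (ℕ.s≤s m≤n) Px = adjoin-mono (rounds-mono m≤n) Px

rounds⊆Generated : ∀ n → rounds n P ⊆ Generated P
rounds⊆Generated zero    Px        = base Px
rounds⊆Generated (suc n) (inj₁ Px) = rounds⊆Generated n Px
rounds⊆Generated (suc n) (inj₂ (_ , _ , Px , Py , inj₁ refl)) =
  meet (rounds⊆Generated n Px) (rounds⊆Generated n Py)
rounds⊆Generated (suc n) (inj₂ (_ , _ , Px , Py , inj₂ refl)) =
  join (rounds⊆Generated n Px) (rounds⊆Generated n Py)

-- Repetitions are harmless here: only membership in `adjoinᴸ xs` is used, and uniqueness is checked
-- on the short explicit lists instead.
meets joins adjoinᴸ : List Energy → List Energy
meets   xs = cartesianProductWith _∧_ xs xs
joins   xs = cartesianProductWith _∨_ xs xs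
adjoinᴸ xs = xs ++ meets xs ++ joins xs

∈-adjoinᴸ⁺ : ∀ xs → adjoin (_∈ xs) ⊆ (_∈ adjoinᴸ xs)
∈-adjoinᴸ⁺ xs (inj₁ x∈) = ∈-++⁺ˡ x∈
∈-adjoinᴸ⁺ xs (inj₂ (_ , _ , x∈ , y∈ , inj₁ refl)) =
  ∈-++⁺ʳ xs (∈-++⁺ˡ (∈-cartesianProductWith⁺ _∧_ x∈ y∈))
∈-adjoinᴸ⁺ xs (inj₂ (_ , _ , x∈ , y∈ , inj₂ refl)) =
  ∈-++⁺ʳ xs (∈-++⁺ʳ (meets xs) (∈-cartesianProductWith⁺ _∨_ x∈ y∈))

∈-adjoinᴸ⁻ : ∀ xs → (_∈ adjoinᴸ xs) ⊆ adjoin (_∈ xs)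
∈-adjoinᴸ⁻ xs = [ inj₁ , [ fromMeet , fromJoin ]′ ∘ ∈-++⁻ (meets xs) ]′ ∘ ∈-++⁻ xs
  where
  fromMeet : (_∈ meets xs) ⊆ adjoin (_∈ xs)
  fromMeet z∈ with x , y , x∈ , y∈ , eq ← ∈-cartesianProductWith⁻ _∧_ xs xs z∈ =
    inj₂ (x , y , x∈ , y∈ , inj₁ eq)

  fromJoin : (_∈ joins xs) ⊆ adjoin (_∈ xs)
  fromJoin z∈ with x , y , x∈ , y∈ , eq ← ∈-cartesianProductWith⁻ _∨_ xs xs z∈ =
    inj₂ (x , y , x∈ , y∈ , inj₂ eq)

adjoinᴸ-closed⇒isSublattice : ∀ xs → adjoinᴸ xs ⊆ᴸ xs → IsSublattice (_∈ xs)
adjoinᴸ-closed⇒isSublattice xs closed = record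
  { ∧-closed = λ x∈ y∈ → closed (∈-adjoinᴸ⁺ xs (inj₂ (_ , _ , x∈ , y∈ , inj₁ refl)))
  ; ∨-closed = λ x∈ y∈ → closed (∈-adjoinᴸ⁺ xs (inj₂ (_ , _ , x∈ , y∈ , inj₂ refl)))
  }

-- `new₁` holds what the first round adds and `new₂` what the second adds; each entry of `new₂` is
-- `PF` met with an entry of `new₁`. Keeping `level₀` as a prefix makes `new` enumerate the
-- complement of `𝒮` in `level₂`.
level₀ new₁ new₂ new level₁ level₂ : List Energy
level₀ = B ∷ 2S ∷ RS ∷ PF ∷ S ∷ RT ∷ FT ∷ R ∷ RV ∷ IF ∷ F ∷ T ∷ E ∷ []
new₁   = PF ∧ RS ∷ PF ∧ RT ∷ PF ∧ FT ∷ PF ∧ S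
       ∷ S ∧ RT ∷ S ∧ FT ∷ S ∧ R ∷ S ∧ RV ∷ S ∧ F
       ∷ IF ∨ RT ∷ IF ∨ FT ∷ IF ∨ R ∷ IF ∨ RV ∷ []
new₂   = PF ∧ (IF ∨ RT) ∷ PF ∧ (IF ∨ FT) ∷ PF ∧ (S ∧ RT) ∷ PF ∧ (S ∧ FT) ∷ []
new    = new₁ ++ new₂
level₁ = level₀ ++ new₁
level₂ = level₀ ++ new

level₂-closed : adjoinᴸ level₂ ⊆ᴸ level₂
level₂-closed = from-yes (adjoinᴸ level₂ ⊆? level₂)

L₃₀⊆level₂ : L₃₀ ⊆ (_∈ level₂)
L₃₀⊆level₂ =
  -- `𝒮` unfolds to membership in `level₀`, the prefix of `level₂`.
  generated-least (adjoinᴸ-closed⇒isSublattice level₂ level₂-closed) ∈-++⁺ˡ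

-- This upper bound serves to show that the second round is not idle.
rounds₁⊆level₁ : rounds 1 𝒮 ⊆ (_∈ level₁)
rounds₁⊆level₁ x∈ = from-yes (adjoinᴸ level₀ ⊆? level₁) (∈-adjoinᴸ⁺ level₀ x∈)

level₁⊆rounds₁ : (_∈ level₁) ⊆ rounds 1 𝒮
level₁⊆rounds₁ x∈ = ∈-adjoinᴸ⁻ level₀ (from-yes (level₁ ⊆? adjoinᴸ level₀) x∈)

-- Each entry is a member, meet or join of entries of `level₁`, all of which are present after one
-- round.
level₂⊆rounds₂ : (_∈ level₂) ⊆ rounds 2 𝒮
level₂⊆rounds₂ x∈ = adjoin-mono level₁⊆rounds₁
  (∈-adjoinᴸ⁻ level₁ (from-yes (level₂ ⊆? adjoinᴸ level₁) x∈))

level₂⊆L₃₀ : (_∈ level₂) ⊆ L₃₀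
level₂⊆L₃₀ x∈ = rounds⊆Generated 2 (level₂⊆rounds₂ x∈)

L₃₀⊆rounds : ∀ n → 2 ≤ℕ n → L₃₀ ⊆ rounds n 𝒮
L₃₀⊆rounds n 2≤n x∈ = rounds-mono 2≤n (level₂⊆rounds₂ (L₃₀⊆level₂ x∈))

-- Both sides equal `L₃₀`: no round leaves it, and from the second on every round contains it.
rounds-≐ : ∀ m n → 2 ≤ℕ m → 2 ≤ℕ n → rounds m 𝒮 ≐ rounds n 𝒮
rounds-≐ m n 2≤m 2≤n =
    (λ x∈ → L₃₀⊆rounds n 2≤n (rounds⊆Generated m x∈))
  , (λ x∈ → L₃₀⊆rounds m 2≤m (rounds⊆Generated n x∈))

new∉𝒮 : All (∁ 𝒮) new
new∉𝒮 = from-yes (all? (λ x → ¬? (x ∈? level₀)) new)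

new⊆L₃₀∖𝒮 : (_∈ new) ⊆ L₃₀ ∩ ∁ 𝒮
new⊆L₃₀∖𝒮 x∈ = level₂⊆L₃₀ (∈-++⁺ʳ level₀ x∈) , All.lookup new∉𝒮 x∈

L₃₀∖𝒮⊆new : L₃₀ ∩ ∁ 𝒮 ⊆ (_∈ new)
L₃₀∖𝒮⊆new (x∈L , x∉𝒮) =
  [ (λ x∈𝒮 → contradiction x∈𝒮 x∉𝒮) , (λ x∈ → x∈) ]′ (∈-++⁻ level₀ (L₃₀⊆level₂ x∈L))

¬isSublattice-𝒮 : ¬ IsSublattice 𝒮
-- The meet is (∞, 2, ∞, ∞, 1, 1), which is none of the 13 vectors.
¬isSublattice-𝒮 sub = from-no (PF ∧ RS ∈? level₀)
  (IsSublattice.∧-closed sub (from-yes (PF ∈? level₀)) (from-yes (RS ∈? level₀)))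

hasCardinality-𝒮 : HasCardinality 𝒮 13
hasCardinality-𝒮 =
  level₀ , from-yes (unique? level₀) , refl , λ _ → mk⇔ (λ x∈ → x∈) (λ x∈ → x∈)

hasCardinality-L₃₀ : HasCardinality L₃₀ 30
hasCardinality-L₃₀ =
  level₂ , from-yes (unique? level₂) , refl , λ _ → mk⇔ level₂⊆L₃₀ L₃₀⊆level₂

hasCardinality-L₃₀∖𝒮 : HasCardinality (L₃₀ ∩ ∁ 𝒮) 17
hasCardinality-L₃₀∖𝒮 =
  new , from-yes (unique? new) , refl , λ _ → mk⇔ new⊆L₃₀∖𝒮 L₃₀∖𝒮⊆new

rounds₁≭rounds₀ : ¬ (rounds 1 𝒮 ≐ rounds 0 𝒮)
rounds₁≭rounds₀ (r₁⊆r₀ , _) =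
  from-no (level₁ ⊆? level₀) (λ x∈ → r₁⊆r₀ (level₁⊆rounds₁ x∈))

rounds₂≭rounds₁ : ¬ (rounds 2 𝒮 ≐ rounds 1 𝒮)
rounds₂≭rounds₁ (r₂⊆r₁ , _) = from-no (level₂ ⊆? level₁)
  (λ x∈ → rounds₁⊆level₁ (r₂⊆r₁ (level₂⊆rounds₂ x∈)))

mainTheorem10 : HasCardinality 𝒮 13
    × ¬ IsSublattice 𝒮
    × HasCardinality L₃₀ 30
    × HasCardinality (L₃₀ ∩ ∁ 𝒮) 17
    × rounds 3 𝒮 ≐ L₃₀
    × (∀ n → 3 ≤ℕ n → rounds n 𝒮 ≐ rounds 3 𝒮)
    × (¬ (rounds 1 𝒮 ≐ rounds 0 𝒮) × ¬ (rounds 2 𝒮 ≐ rounds 1 𝒮) × rounds 3 𝒮 ≐ rounds 2 𝒮)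
mainTheorem10 =
    hasCardinality-𝒮
  , ¬isSublattice-𝒮
  , hasCardinality-L₃₀
  , hasCardinality-L₃₀∖𝒮
  , (rounds⊆Generated 3 , L₃₀⊆rounds 3 2≤3)
  , (λ n 3≤n → rounds-≐ n 3 (ℕ.≤-trans 2≤3 3≤n) 2≤3)
  , rounds₁≭rounds₀
  , rounds₂≭rounds₁
  -- The third round adds nothing: it is the one that witnesses stabilization.
  , rounds-≐ 3 2 2≤3 ℕ.≤-refl
  where
  2≤3 : 2 ≤ℕ 3
  2≤3 = ℕ.n≤1+n 2
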